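{- Let $k>r\ge 2$ and $m\ge 1$ be integers and let $n\ge k+\binom{k-2}{r-1}$. If $T(n,K_k^{(r)})=T(n,K_k^{(r)};m)$, then $$m\le \left\lfloor\frac{k-1}{r-1}\right\rfloor.$$
   Context: An $r$-graph ($r$-uniform hypergraph) is a pair $H=(V,E)$ with $V$ a finite vertex set and $E$ a set of $r$-element subsets of $V$. Connected components of a hypergraph are taken in the usual sense (isolated vertices count as components). Say an $r$-graph on vertex set $V$ satisfies the covering condition for $k$ if every $k$-element subset of $V$ contains at least one edge. $T(n,K_k^{(r)})$ denotes the smallest integer $t$ such that there exists an $r$-graph with $n$ vertices and $t$ edges satisfying the covering condition for $k$. For an integer $m\ge1$, $T(n,K_k^{(r)};m)$ denotes the smallest integer $t$ such that there exists an $r$-graph with $n$ vertices, $t$ edges and exactly $m$ connected components satisfying the covering condition for $k$. -}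

module Defs where

open import Data.Nat using (ℕ; zero; suc; _≤_)
open import Data.Nat.DivMod using (_/_)
open import Data.Fin using (Fin)
open import Data.Fin.Subset using (Subset; _⊆_; ∣_∣) renaming (_∈_ to _∈ₛ_)
open import Data.List using (List; length)
open import Data.List.Membership.Propositional using (_∈_)
open import Data.List.Relation.Unary.All using (All)
open import Data.List.Relation.Unary.Unique.Propositional using (Unique)
open import Data.Product using (Σ; ∃; _×_)
open import Function.Bundles using (_⇔_)
open import Relation.Binary.PropositionalEquality using (_≡_)
open import Relation.Binary.Construct.Closure.ReflexiveTransitive using (Star)

record RGraph (r n : ℕ) : Set where
  field
    edges    : List (Subset n)
    distinct : Unique edges
    uniform  : All (λ e → ∣ e ∣ ≡ r) edges
open RGraph public

∥_∥ : ∀ {r n} → RGraph r n → ℕ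
∥ H ∥ = length (edges H)

Covers : ∀ {r n} → ℕ → RGraph r n → Set
Covers {r} {n} k H = (S : Subset n) → ∣ S ∣ ≡ k → Σ (Subset n) λ e → e ∈ edges H × e ⊆ S

Adj : ∀ {r n} → RGraph r n → Fin n → Fin n → Set
Adj {r} {n} H u v = Σ (Subset n) λ e → e ∈ edges H × u ∈ₛ e × v ∈ₛ e

Connected : ∀ {r n} → RGraph r n → Fin n → Fin n → Set
Connected H = Star (Adj H)

HasComponents : ∀ {r n} → ℕ → RGraph r n → Set
HasComponents {r} {n} m H =
  Σ (Fin n → Fin m) λ c →
    ((j : Fin m) → ∃ λ v → c v ≡ j) ×
    ((u v : Fin n) → (c u ≡ c v) ⇔ Connected H u v)

IsT : ℕ → ℕ → ℕ → ℕ → Set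
IsT n k r t =
  (Σ (RGraph r n) λ H → Covers k H × ∥ H ∥ ≡ t) ×
  ((H : RGraph r n) → Covers k H → t ≤ ∥ H ∥)

IsTm : ℕ → ℕ → ℕ → ℕ → ℕ → Set
IsTm n k r m t =
  (Σ (RGraph r n) λ H → Covers k H × HasComponents m H × ∥ H ∥ ≡ t) ×
  ((H : RGraph r n) → Covers k H → HasComponents m H → t ≤ ∥ H ∥)

-- floor division (divisor 0 never used below since r ≥ 2)
_div_ : ℕ → ℕ → ℕ
a div zero = zero
a div suc b = a / suc b

{-# OPTIONS --safe #-}
module Submission where

-- An optimal H has no isolated vertex. Suppose v is isolated and let I be a
-- maximal independent set avoiding v; then ∣I∣ ≤ k - 2, since I ∪ {v} is
-- independent too. Every vertex u outside I ∪ {v} completes some (r-1)-subset of I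
-- to an edge, and n is so large that two of them complete the same subset A.
-- Replacing these two edges by A ∪ {v} keeps the covering condition and saves an
-- edge. Hence each of the m components contains an edge; deleting one vertex from
-- one edge per component and taking the union gives an independent set of size
-- m(r-1), so m(r-1) ≤ k - 1.

open import Defs
open import Data.Nat using (ℕ; zero; suc; _+_; _*_; _∸_; _≤_; _<_; z≤n; s≤s; s≤s⁻¹)
open import Data.Nat.Combinatorics using (_C_; nCk+nC[k+1]≡[n+1]C[k+1])
open import Data.Nat.DivMod using (m*n/n≡m; /-monoˡ-≤)
open import Data.Nat.Properties hiding (suc-injective; <⇒≢)
open import Data.Fin using (Fin; zero; suc)
open import Data.Fin.Properties using (pigeonhole; suc-injective; <⇒≢) renaming (_≟_ to _≟ᶠ_)
open import Data.Fin.Subset using (Subset; inside; outside; _⊆_; ∣_∣; ⊥; ⁅_⁆; _∪_; _-_; ∁)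
  renaming (_∈_ to _∈ₛ_; _∉_ to _∉ₛ_)
open import Data.Fin.Subset.Properties
open import Data.Bool.Properties using () renaming (_≟_ to _≟ᵇ_)
open import Data.List using (List; []; _∷_; _++_; map; length; filter; lookup; allFin)
open import Data.List.Properties using (length-++; length-map; filter-notAll)
open import Data.List.Membership.Propositional using (_∈_; lose; find)
open import Data.List.Membership.Propositional.Properties
  using (∈-map⁺; ∈-++⁺ˡ; ∈-++⁺ʳ; ∈-filter⁺; ∈-filter⁻; ∈-allFin)
open import Data.List.Relation.Unary.All as All using ()
open import Data.List.Relation.Unary.AllPairs using (_∷_)
open import Data.List.Relation.Unary.Any as Any using (Any; here; there)
open import Data.List.Relation.Unary.Any.Properties using (lookup-index)
open import Data.List.Relation.Unary.Unique.Propositional.Properties as Unique using ()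
open import Data.Product using (Σ; ∃; _×_; _,_; proj₁; proj₂; -,_)
open import Data.Sum using (_⊎_; inj₁; inj₂; [_,_]′)
open import Data.Vec using ([]; _∷_; here; there)
open import Data.Vec.Properties using (≡-dec)
open import Function using (_∘_)
open import Function.Bundles using (Equivalence)
open import Relation.Binary.Construct.Closure.ReflexiveTransitive using (ε; _◅_)
open import Relation.Binary.Definitions using (DecidableEquality)
open import Relation.Binary.PropositionalEquality
open import Relation.Nullary using (¬_; yes; no; contradiction; ¬?)
open import Relation.Unary using (Decidable)

-- Cardinalities of finite subsets

private variable
  n : ℕ

_≟ₛ_ : DecidableEquality (Subset n)
_≟ₛ_ = ≡-dec _≟ᵇ_

∣p∪q∣≡∣p∣+∣q∣ : (p q : Subset n) → (∀ {x} → x ∈ₛ p → x ∉ₛ q) → ∣ p ∪ q ∣ ≡ ∣ p ∣ + ∣ q ∣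
∣p∪q∣≡∣p∣+∣q∣ []            []            disj = refl
∣p∪q∣≡∣p∣+∣q∣ (outside ∷ p) (outside ∷ q) disj = ∣p∪q∣≡∣p∣+∣q∣ p q λ x∈p x∈q → disj (there x∈p) (there x∈q)
∣p∪q∣≡∣p∣+∣q∣ (inside  ∷ p) (outside ∷ q) disj =
  cong suc (∣p∪q∣≡∣p∣+∣q∣ p q λ x∈p x∈q → disj (there x∈p) (there x∈q))
∣p∪q∣≡∣p∣+∣q∣ (outside ∷ p) (inside  ∷ q) disj =
  trans (cong suc (∣p∪q∣≡∣p∣+∣q∣ p q λ x∈p x∈q → disj (there x∈p) (there x∈q))) (sym (+-suc ∣ p ∣ ∣ q ∣))
∣p∪q∣≡∣p∣+∣q∣ (inside  ∷ p) (inside  ∷ q) disj = contradiction here (disj here)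

∣p∪⁅x⁆∣≡1+∣p∣ : {p : Subset n} {x : Fin n} → x ∉ₛ p → ∣ p ∪ ⁅ x ⁆ ∣ ≡ suc ∣ p ∣
∣p∪⁅x⁆∣≡1+∣p∣ {p = p} {x} x∉p = begin
  ∣ p ∪ ⁅ x ⁆ ∣      ≡⟨ ∣p∪q∣≡∣p∣+∣q∣ p ⁅ x ⁆ disj ⟩
  ∣ p ∣ + ∣ ⁅ x ⁆ ∣  ≡⟨ cong (∣ p ∣ +_) (∣⁅x⁆∣≡1 x) ⟩
  ∣ p ∣ + 1          ≡⟨ +-comm ∣ p ∣ 1 ⟩
  suc ∣ p ∣          ∎
  where
  open ≡-Reasoning
  disj : ∀ {y} → y ∈ₛ p → y ∉ₛ ⁅ x ⁆
  disj y∈p y∈x with refl ← x∈⁅y⁆⇒x≡y x y∈x = x∉p y∈p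

x∈p∪⁅x⁆ : (p : Subset n) (x : Fin n) → x ∈ₛ p ∪ ⁅ x ⁆
x∈p∪⁅x⁆ p x = q⊆p∪q p ⁅ x ⁆ (x∈⁅x⁆ x)

p∪⁅x⁆⊆q : {p q : Subset n} {x : Fin n} → p ⊆ q → x ∈ₛ q → p ∪ ⁅ x ⁆ ⊆ q
p∪⁅x⁆⊆q {p = p} {x = x} p⊆q x∈q y∈ with x∈p∪q⁻ p ⁅ x ⁆ y∈
... | inj₁ y∈p = p⊆q y∈p
... | inj₂ y∈x with refl ← x∈⁅y⁆⇒x≡y x y∈x = x∈q

p-x⊆p : (p : Subset n) (x : Fin n) → p - x ⊆ p
p-x⊆p p x = p─q⊆p p ⁅ x ⁆

x∉p-x : (p : Subset n) (x : Fin n) → x ∉ₛ p - x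
x∉p-x (s ∷ p) zero    ()
x∉p-x (s ∷ p) (suc x) (there x∈) = x∉p-x p x x∈

q⊆p∪⁅x⁆∧x∉q⇒q⊆p : {p q : Subset n} {x : Fin n} → q ⊆ p ∪ ⁅ x ⁆ → x ∉ₛ q → q ⊆ p
q⊆p∪⁅x⁆∧x∉q⇒q⊆p {p = p} {x = x} q⊆ x∉q y∈q with x∈p∪q⁻ p ⁅ x ⁆ (q⊆ y∈q)
... | inj₁ y∈p = y∈p
... | inj₂ y∈x with refl ← x∈⁅y⁆⇒x≡y x y∈x = contradiction y∈q x∉q

1+∣p-x∣≡∣p∣ : {p : Subset n} {x : Fin n} → x ∈ₛ p → suc ∣ p - x ∣ ≡ ∣ p ∣
1+∣p-x∣≡∣p∣ {p = p} {x} x∈p = begin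
  suc ∣ p - x ∣          ≡⟨ ∣p∪⁅x⁆∣≡1+∣p∣ (x∉p-x p x) ⟨
  ∣ (p - x) ∪ ⁅ x ⁆ ∣    ≡⟨ cong ∣_∣ (⊆-antisym (p∪⁅x⁆⊆q (p-x⊆p p x) x∈p) p⊆) ⟩
  ∣ p ∣                  ∎
  where
  open ≡-Reasoning
  p⊆ : p ⊆ (p - x) ∪ ⁅ x ⁆
  p⊆ {y} y∈p with y ≟ᶠ x
  ... | yes refl = x∈p∪⁅x⁆ (p - x) x
  ... | no y≢x   = p⊆p∪q ⁅ x ⁆ (x∈p∧x≢y⇒x∈p-y y∈p y≢x)

0<∣p∣⇒nonempty : (p : Subset n) → 0 < ∣ p ∣ → ∃ λ x → x ∈ₛ p
0<∣p∣⇒nonempty (inside  ∷ p) _   = zero , here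
0<∣p∣⇒nonempty (outside ∷ p) 0<p with x , x∈p ← 0<∣p∣⇒nonempty p 0<p = suc x , there x∈p

∃⊆-ofSize : ∀ {j} (p : Subset n) → j ≤ ∣ p ∣ → ∃ λ q → q ⊆ p × ∣ q ∣ ≡ j
∃⊆-ofSize {n} {zero} p _ = ⊥ , ⊆-min p , ∣⊥∣≡0 n
∃⊆-ofSize {j = suc j} (outside ∷ p) j≤p with q , q⊆p , q≡j ← ∃⊆-ofSize p j≤p =
  outside ∷ q , s⊆s q⊆p , q≡j
∃⊆-ofSize {j = suc j} (inside ∷ p) (s≤s j≤p) with q , q⊆p , q≡j ← ∃⊆-ofSize p j≤p =
  inside ∷ q , s⊆s q⊆p , cong suc q≡j

-- Used to glue the pieces taken from the `m` components into one large set.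
∃-disjointUnion : ∀ {s} m (A : Fin m → Subset n) → (∀ i → ∣ A i ∣ ≡ s) →
                  (∀ {i j x} → x ∈ₛ A i → x ∈ₛ A j → i ≡ j) →
                  ∃ λ U → ∣ U ∣ ≡ m * s × (∀ {x} → x ∈ₛ U → ∃ λ i → x ∈ₛ A i)
∃-disjointUnion {n} zero A size disj = ⊥ , ∣⊥∣≡0 n , λ x∈ → contradiction x∈ ∉⊥
∃-disjointUnion (suc m) A size disj
  with U , ∣U∣ , U⊆ ← ∃-disjointUnion m (A ∘ suc) (size ∘ suc) (λ a b → suc-injective (disj a b)) =
    A zero ∪ U
  , trans (∣p∪q∣≡∣p∣+∣q∣ (A zero) U A₀∩U) (cong₂ _+_ (size zero) ∣U∣)
  , λ x∈ → [ (zero ,_) , (λ x∈U → -, proj₂ (U⊆ x∈U)) ]′ (x∈p∪q⁻ (A zero) U x∈)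
  where
  A₀∩U : ∀ {x} → x ∈ₛ A zero → x ∉ₛ U
  A₀∩U x∈A₀ x∈U with i , x∈Ai ← U⊆ x∈U with () ← disj x∈A₀ x∈Ai

-- Enumeration and counting of subsets

enum : (p : Subset n) → Fin ∣ p ∣ → Fin n
enum (inside  ∷ p) zero    = zero
enum (inside  ∷ p) (suc i) = suc (enum p i)
enum (outside ∷ p) i       = suc (enum p i)

enum-∈ : (p : Subset n) (i : Fin ∣ p ∣) → enum p i ∈ₛ p
enum-∈ (inside  ∷ p) zero    = here
enum-∈ (inside  ∷ p) (suc i) = there (enum-∈ p i)
enum-∈ (outside ∷ p) i       = there (enum-∈ p i)

enum-injective : (p : Subset n) {i j : Fin ∣ p ∣} → enum p i ≡ enum p j → i ≡ j
enum-injective (inside  ∷ p) {zero}  {zero}  eq = refl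
enum-injective (inside  ∷ p) {suc i} {suc j} eq = cong suc (enum-injective p (suc-injective eq))
enum-injective (outside ∷ p) eq = enum-injective p (suc-injective eq)

subsetsOfSize : ℕ → Subset n → List (Subset n)
subsetsOfSize zero    p             = ⊥ ∷ []
subsetsOfSize (suc j) []            = []
subsetsOfSize (suc j) (outside ∷ p) = map (outside ∷_) (subsetsOfSize (suc j) p)
subsetsOfSize (suc j) (inside  ∷ p) =
  map (inside ∷_) (subsetsOfSize j p) ++ map (outside ∷_) (subsetsOfSize (suc j) p)

-- Splitting on whether the first element is taken is Pascal's rule, so list and binomial
-- coefficient obey the same recursion.
length-subsetsOfSize : ∀ j (p : Subset n) → length (subsetsOfSize j p) ≡ ∣ p ∣ C j
length-subsetsOfSize zero    p  = refl
length-subsetsOfSize (suc j) [] = refl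
length-subsetsOfSize (suc j) (outside ∷ p) =
  trans (length-map _ (subsetsOfSize (suc j) p)) (length-subsetsOfSize (suc j) p)
length-subsetsOfSize (suc j) (inside ∷ p) = begin
  length (map (inside ∷_) ps ++ map (outside ∷_) qs)            ≡⟨ length-++ (map (inside ∷_) ps) ⟩
  length (map (inside ∷_) ps) + length (map (outside ∷_) qs)    ≡⟨ cong₂ _+_ (length-map _ ps) (length-map _ qs) ⟩
  length ps + length qs
    ≡⟨ cong₂ _+_ (length-subsetsOfSize j p) (length-subsetsOfSize (suc j) p) ⟩
  ∣ p ∣ C j + ∣ p ∣ C suc j                                     ≡⟨ nCk+nC[k+1]≡[n+1]C[k+1] ∣ p ∣ j ⟩
  suc ∣ p ∣ C suc j                                             ∎
  where
  open ≡-Reasoning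
  ps = subsetsOfSize j p
  qs = subsetsOfSize (suc j) p

-- The position that this membership proof gives to `q` later serves as its pigeonhole.
∈-subsetsOfSize : ∀ j {p q : Subset n} → q ⊆ p → ∣ q ∣ ≡ j → q ∈ subsetsOfSize j p
∈-subsetsOfSize zero {p} {q} q⊆p ∣q∣≡0 = here (Empty-unique empty)
  where
  empty : ¬ ∃ λ x → x ∈ₛ q
  empty (x , x∈q) with () ← trans (1+∣p-x∣≡∣p∣ x∈q) ∣q∣≡0
∈-subsetsOfSize (suc j) {outside ∷ p} {inside  ∷ q} q⊆p eq with () ← q⊆p here
∈-subsetsOfSize (suc j) {outside ∷ p} {outside ∷ q} q⊆p eq =
  ∈-map⁺ _ (∈-subsetsOfSize (suc j) (drop-∷-⊆ q⊆p) eq)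
∈-subsetsOfSize (suc j) {inside ∷ p} {inside ∷ q} q⊆p eq =
  ∈-++⁺ˡ (∈-map⁺ _ (∈-subsetsOfSize j (drop-∷-⊆ q⊆p) (cong (_∸ 1) eq)))
∈-subsetsOfSize (suc j) {inside ∷ p} {outside ∷ q} q⊆p eq =
  ∈-++⁺ʳ (map (inside ∷_) (subsetsOfSize j p)) (∈-map⁺ _ (∈-subsetsOfSize (suc j) (drop-∷-⊆ q⊆p) eq))

C-monoˡ-≤ : ∀ j {a b} → a ≤ b → a C j ≤ b C j
C-monoˡ-≤ zero    _ = ≤-refl
C-monoˡ-≤ (suc j) {zero} {b} _ = z≤n
C-monoˡ-≤ (suc j) {suc a} {suc b} (s≤s a≤b) = begin
  suc a C suc j        ≡⟨ nCk+nC[k+1]≡[n+1]C[k+1] a j ⟨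
  a C j + a C suc j    ≤⟨ +-mono-≤ (C-monoˡ-≤ j a≤b) (C-monoˡ-≤ (suc j) a≤b) ⟩
  b C j + b C suc j    ≡⟨ nCk+nC[k+1]≡[n+1]C[k+1] b j ⟩
  suc b C suc j        ∎
  where open ≤-Reasoning

-- Maximal sets without an upward closed property

module _ {P : Subset n → Set} (P? : Decidable P) (P-up : ∀ {p q} → p ⊆ q → P p → P q) (¬P⊥ : ¬ P ⊥) where

  private
    greedy : (xs : List (Fin n)) → ∃ λ I → ¬ P I × (∀ {x} → x ∈ xs → x ∉ₛ I → P (I ∪ ⁅ x ⁆))
    greedy [] = ⊥ , ¬P⊥ , λ ()
    greedy (x ∷ xs) with I , ¬PI , max ← greedy xs with P? (I ∪ ⁅ x ⁆)
    ... | yes PIx = I , ¬PI , λ { (here refl) _ → PIx ; (there y∈) → max y∈ }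
    -- The set grows here, and upward closure of `P` keeps every element rejected before rejected.
    ... | no ¬PIx = I ∪ ⁅ x ⁆ , ¬PIx , λ
      { (here refl) x∉ → contradiction (x∈p∪⁅x⁆ I x) x∉
      ; {y} (there y∈) y∉ → P-up (p∪⁅x⁆⊆q (p⊆p∪q ⁅ y ⁆ ∘ p⊆p∪q ⁅ x ⁆) (x∈p∪⁅x⁆ _ y)) (max y∈ (y∉ ∘ p⊆p∪q ⁅ x ⁆)) }

  ∃-maximal : ∃ λ I → ¬ P I × (∀ {x} → x ∉ₛ I → P (I ∪ ⁅ x ⁆))
  ∃-maximal with I , ¬PI , max ← greedy (allFin n) = I , ¬PI , max (∈-allFin _)

-- Isolated vertices

module _ {r n k : ℕ} (H : RGraph r n) (covers : Covers k H) where

  Dependent : Subset n → Set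
  Dependent S = Any (_⊆ S) (edges H)

  ∣edge∣≡r : ∀ {e} → e ∈ edges H → ∣ e ∣ ≡ r
  ∣edge∣≡r = All.lookup (uniform H)

  k≤∣S∣⇒Dependent : ∀ {S} → k ≤ ∣ S ∣ → Dependent S
  k≤∣S∣⇒Dependent {S} k≤S with q , q⊆S , ∣q∣≡k ← ∃⊆-ofSize S k≤S with e , e∈ , e⊆q ← covers q ∣q∣≡k =
    lose e∈ (q⊆S ∘ e⊆q)

  module _ {v : Fin n} (isolated : ∀ {e} → e ∈ edges H → v ∉ₛ e) where

    -- Adding `v` brings `S` up to at least `k` elements, and the edge found there misses the
    -- isolated `v`, so it already lies in `S`.
    k≤1+∣S∣⇒Dependent : ∀ {S} → k ≤ suc ∣ S ∣ → v ∉ₛ S → Dependent S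
    k≤1+∣S∣⇒Dependent {S} k≤ v∉S
      with e , e∈ , e⊆ ← find (k≤∣S∣⇒Dependent {S ∪ ⁅ v ⁆} (≤-trans k≤ (≤-reflexive (sym (∣p∪⁅x⁆∣≡1+∣p∣ v∉S))))) =
      lose e∈ (q⊆p∪⁅x⁆∧x∉q⇒q⊆p e⊆ (isolated e∈))

    -- A k-set S avoiding v stays covered: for a ∈ A, the set S - a still has at least
    -- k - 1 elements, so it contains an edge of H, which misses a and so is not e₁ or e₂.
    shareSubset⇒∃-smaller : ∀ {A e₁ e₂} → 0 < ∣ A ∣ → suc ∣ A ∣ ≡ r → e₁ ∈ edges H → e₂ ∈ edges H →
      e₁ ≢ e₂ → A ⊆ e₁ → A ⊆ e₂ → Σ (RGraph r n) λ H′ → Covers k H′ × ∥ H′ ∥ < ∥ H ∥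
    shareSubset⇒∃-smaller {A} {e₁} {e₂} 0<A ∣A∣ e₁∈ e₂∈ e₁≢e₂ A⊆e₁ A⊆e₂ = H′ , covers′ , smaller
      where
      v∉A : v ∉ₛ A
      v∉A = isolated e₁∈ ∘ A⊆e₁

      a = proj₁ (0<∣p∣⇒nonempty A 0<A)
      a∈A = proj₂ (0<∣p∣⇒nonempty A 0<A)

      f = A ∪ ⁅ v ⁆

      es₁ = filter (λ e → ¬? (e ≟ₛ e₁)) (edges H)
      es₂ = filter (λ e → ¬? (e ≟ₛ e₂)) es₁

      es₂⊆ : ∀ {e} → e ∈ es₂ → e ∈ edges H
      es₂⊆ = proj₁ ∘ ∈-filter⁻ (λ e → ¬? (e ≟ₛ e₁)) ∘ proj₁ ∘ ∈-filter⁻ (λ e → ¬? (e ≟ₛ e₂))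

      ∈es₂ : ∀ {e} → e ∈ edges H → e ≢ e₁ → e ≢ e₂ → e ∈ es₂
      ∈es₂ e∈ ≢₁ ≢₂ = ∈-filter⁺ _ (∈-filter⁺ _ e∈ ≢₁) ≢₂

      H′ : RGraph r n
      H′ .edges    = f ∷ es₂
      -- The new edge contains `v`, which no old edge does.
      H′ .distinct = All.tabulate (λ { e∈ refl → isolated (es₂⊆ e∈) (x∈p∪⁅x⁆ A v) })
                   ∷ Unique.filter⁺ _ (Unique.filter⁺ _ (distinct H))
      H′ .uniform  = trans (∣p∪⁅x⁆∣≡1+∣p∣ v∉A) ∣A∣ All.∷ All.tabulate (∣edge∣≡r ∘ es₂⊆)

      smaller : ∥ H′ ∥ < ∥ H ∥
      smaller = <-≤-trans
        -- Two edges go and one comes: as `e₁ ≢ e₂`, the edge `e₂` survives the first filter and is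
        -- removed by the second.
        (s≤s (filter-notAll _ es₁ (lose (∈-filter⁺ _ e₂∈ (e₁≢e₂ ∘ sym)) (λ ≢ → ≢ refl))))
        (filter-notAll _ (edges H) (lose e₁∈ (λ ≢ → ≢ refl)))

      avoiding-a : ∀ {e S} → e ∈ edges H → a ∉ₛ e → e ⊆ S → Σ (Subset n) λ e → e ∈ edges H′ × e ⊆ S
      avoiding-a e∈ a∉e e⊆S = -, there (∈es₂ e∈ (λ { refl → a∉e (A⊆e₁ a∈A) }) (λ { refl → a∉e (A⊆e₂ a∈A) })) , e⊆S

      covers′ : Covers k H′
      covers′ S ∣S∣ with v ∈? S
      -- The set `S - v` has k - 1 elements and avoids `v`, so it contains an old edge. If that edge
      -- was removed, it contained `A`, and together with `v ∈ S` this puts `f` inside `S`.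
      covers′ S ∣S∣ | yes v∈S
        with e , e∈ , e⊆ ← find (k≤1+∣S∣⇒Dependent {S - v}
               (≤-reflexive (trans (sym ∣S∣) (sym (1+∣p-x∣≡∣p∣ v∈S)))) (x∉p-x S v))
        with e ≟ₛ e₁ | e ≟ₛ e₂
      ... | yes refl | _        = f , here refl , p∪⁅x⁆⊆q (p-x⊆p S v ∘ e⊆ ∘ A⊆e₁) v∈S
      ... | no _     | yes refl = f , here refl , p∪⁅x⁆⊆q (p-x⊆p S v ∘ e⊆ ∘ A⊆e₂) v∈S
      ... | no ≢₁    | no ≢₂    = e , there (∈es₂ e∈ ≢₁ ≢₂) , p-x⊆p S v ∘ e⊆
      covers′ S ∣S∣ | no v∉S with a ∈? S
      ... | yes a∈S
        with e , e∈ , e⊆ ← find (k≤1+∣S∣⇒Dependent {S - a}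
               (≤-reflexive (trans (sym ∣S∣) (sym (1+∣p-x∣≡∣p∣ a∈S)))) (v∉S ∘ p-x⊆p S a)) =
        avoiding-a e∈ (x∉p-x S a ∘ e⊆) (p-x⊆p S a ∘ e⊆)
      ... | no a∉S with e , e∈ , e⊆ ← covers S ∣S∣ = avoiding-a e∈ (a∉S ∘ e⊆) e⊆

    module _ (2≤r : 2 ≤ r) (large : k + ((k ∸ 2) C (r ∸ 1)) ≤ n) where

      private
        -- Merging the two conditions into one upward closed property makes `∃-maximal` yield a set
        -- that is maximal among the independent sets avoiding `v`.
        Blocked : Subset n → Set
        Blocked S = v ∈ₛ S ⊎ Dependent S

        blocked? : Decidable Blocked
        blocked? S with v ∈? S | Any.any? (_⊆? S) (edges H)
        ... | yes v∈S | _       = yes (inj₁ v∈S)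
        ... | no  _   | yes dep = yes (inj₂ dep)
        ... | no  v∉S | no ¬dep = no [ v∉S , ¬dep ]′

        blocked-up : ∀ {p q} → p ⊆ q → Blocked p → Blocked q
        blocked-up p⊆q (inj₁ v∈p) = inj₁ (p⊆q v∈p)
        blocked-up p⊆q (inj₂ dep) with e , e∈ , e⊆p ← find dep = inj₂ (lose e∈ (p⊆q ∘ e⊆p))

        ¬blocked-⊥ : ¬ Blocked ⊥
        ¬blocked-⊥ (inj₁ v∈⊥) = ∉⊥ v∈⊥
        ¬blocked-⊥ (inj₂ dep) with e , e∈ , e⊆⊥ ← find dep
          with x , x∈e ← 0<∣p∣⇒nonempty e (subst (0 <_) (sym (∣edge∣≡r e∈)) (≤-trans (n≤1+n 1) 2≤r)) =
          ∉⊥ (e⊆⊥ x∈e)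

      -- Pigeonhole: the pigeons are the vertices outside `I ∪ ⁅ v ⁆`, the holes the (r-1)-subsets
      -- of `I`. A vertex `u` goes to the hole `e - u`, where `e` is the edge it completes.
      isolated⇒∃-smaller : Σ (RGraph r n) λ H′ → Covers k H′ × ∥ H′ ∥ < ∥ H ∥
      isolated⇒∃-smaller with I , ¬blocked , max ← ∃-maximal blocked? blocked-up ¬blocked-⊥ = result
        where
        v∉I : v ∉ₛ I
        v∉I = ¬blocked ∘ inj₁

        1+∣I∣<k : suc ∣ I ∣ < k
        1+∣I∣<k = ≰⇒> (λ k≤ → ¬blocked (inj₂ (k≤1+∣S∣⇒Dependent k≤ v∉I)))

        ∣I∣≤k∸2 : ∣ I ∣ ≤ k ∸ 2
        ∣I∣≤k∸2 = ∸-monoˡ-≤ 2 1+∣I∣<k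

        O = ∁ (I ∪ ⁅ v ⁆)

        subsets = subsetsOfSize (r ∸ 1) I

        subsets<O : length subsets < ∣ O ∣
        subsets<O = begin-strict
          length subsets                    ≡⟨ length-subsetsOfSize (r ∸ 1) I ⟩
          ∣ I ∣ C (r ∸ 1)                   ≤⟨ C-monoˡ-≤ (r ∸ 1) ∣I∣≤k∸2 ⟩
          -- From ∣I∣ + 2 ≤ k and c + k ≤ n follows (c + 1) + (∣I∣ + 1) ≤ n.
          c                                 <⟨ m+n≤o⇒m≤o∸n (suc c) (≤-trans (≤-reflexive (sym (+-suc c (suc ∣ I ∣))))
                                                 (≤-trans (+-monoʳ-≤ c 1+∣I∣<k) (≤-trans (≤-reflexive (+-comm c k)) large))) ⟩
          n ∸ suc ∣ I ∣                     ≡⟨ cong (n ∸_) (∣p∪⁅x⁆∣≡1+∣p∣ v∉I) ⟨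
          n ∸ ∣ I ∪ ⁅ v ⁆ ∣                 ≡⟨ ∣∁p∣≡n∸∣p∣ (I ∪ ⁅ v ⁆) ⟨
          ∣ O ∣                             ∎
          where
          open ≤-Reasoning
          c = (k ∸ 2) C (r ∸ 1)

        module _ (i : Fin ∣ O ∣) where
          u : Fin n
          u = enum O i

          u∉I∪v : u ∉ₛ I ∪ ⁅ v ⁆
          u∉I∪v = x∈∁p⇒x∉p (enum-∈ O i)

          u∉I : u ∉ₛ I
          u∉I = u∉I∪v ∘ p⊆p∪q ⁅ v ⁆

          dependent : Dependent (I ∪ ⁅ u ⁆)
          -- By maximality `I ∪ ⁅ u ⁆` is blocked, and not through `v`, since `v` differs from `u`
          -- and lies outside `I`.
          dependent with max u∉I
          ... | inj₂ dep = dep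
          ... | inj₁ v∈ with x∈p∪q⁻ I ⁅ u ⁆ v∈
          ...   | inj₁ v∈I = contradiction v∈I v∉I
          ...   | inj₂ v∈u = contradiction
                  (subst (_∈ₛ I ∪ ⁅ v ⁆) (x∈⁅y⁆⇒x≡y u v∈u) (x∈p∪⁅x⁆ I v)) u∉I∪v

          e : Subset n
          e = proj₁ (find dependent)

          e∈ : e ∈ edges H
          e∈ = proj₁ (proj₂ (find dependent))

          e⊆ : e ⊆ I ∪ ⁅ u ⁆
          e⊆ = proj₂ (proj₂ (find dependent))

          -- Otherwise `e` would lie inside the independent set `I`.
          u∈e : u ∈ₛ e
          u∈e with u ∈? e
          ... | yes u∈e = u∈e
          ... | no  u∉e = contradiction (inj₂ (lose {P = _⊆ I} e∈ (q⊆p∪⁅x⁆∧x∉q⇒q⊆p e⊆ u∉e))) ¬blocked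

          1+∣e-u∣≡r : suc ∣ e - u ∣ ≡ r
          1+∣e-u∣≡r = trans (1+∣p-x∣≡∣p∣ u∈e) (∣edge∣≡r e∈)

          e-u∈subsets : e - u ∈ subsets
          e-u∈subsets = ∈-subsetsOfSize (r ∸ 1)
            (q⊆p∪⁅x⁆∧x∉q⇒q⊆p (e⊆ ∘ p-x⊆p e u) (x∉p-x e u)) (cong (_∸ 1) 1+∣e-u∣≡r)

        result : Σ (RGraph r n) λ H′ → Covers k H′ × ∥ H′ ∥ < ∥ H ∥
        result with i , j , i<j , eq ← pigeonhole subsets<O (Any.index ∘ e-u∈subsets) =
          -- The shared set has r - 1 elements, so it is nonempty by `2≤r`.
          shareSubset⇒∃-smaller (s≤s⁻¹ (subst (2 ≤_) (sym (1+∣e-u∣≡r i)) 2≤r)) (1+∣e-u∣≡r i) (e∈ i) (e∈ j) e≢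
            (p-x⊆p (e i) (u i)) (subst (_⊆ e j) (sym A≡) (p-x⊆p (e j) (u j)))
          where
          A≡ : e i - u i ≡ e j - u j
          A≡ = trans (lookup-index (e-u∈subsets i))
                 (trans (cong (lookup subsets) eq) (sym (lookup-index (e-u∈subsets j))))

          e≢ : e i ≢ e j
          -- The only vertex of `e j` outside `I` is `u j`, so equal edges would force `u i` to be
          -- `u j`.
          e≢ ei≡ej with x∈p∪q⁻ I ⁅ u j ⁆ (e⊆ j (subst (u i ∈ₛ_) ei≡ej (u∈e i)))
          ... | inj₁ ui∈I  = u∉I i ui∈I
          ... | inj₂ ui∈uj = <⇒≢ i<j (enum-injective O (x∈⁅y⁆⇒x≡y (u j) ui∈uj))

-- Components

  -- Each component offers an edge through a representative `w j`; dropping `w j` leaves `A j`. The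
  -- union of these sets has m(r-1) elements and is independent, so its size is below `k`.
  noIsolated⇒m*[r∸1]<k : ∀ {m} → HasComponents m H → 1 ≤ r →
    (∀ v → ∃ λ e → e ∈ edges H × v ∈ₛ e) → m * (r ∸ 1) < k
  noIsolated⇒m*[r∸1]<k {m} (c , surj , comp) 1≤r edgeAt =
    let U , ∣U∣ , U⊆ = ∃-disjointUnion m A ∣A∣ A-disjoint in
    ≰⇒> λ k≤ → independent U⊆ (k≤∣S∣⇒Dependent (≤-trans k≤ (≤-reflexive (sym ∣U∣))))
    where
    w : Fin m → Fin n
    w j = proj₁ (surj j)

    E : Fin m → Subset n
    E j = proj₁ (edgeAt (w j))

    E∈ : ∀ j → E j ∈ edges H
    E∈ j = proj₁ (proj₂ (edgeAt (w j)))

    w∈E : ∀ j → w j ∈ₛ E j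
    w∈E j = proj₂ (proj₂ (edgeAt (w j)))

    A : Fin m → Subset n
    A j = E j - w j

    ∣A∣ : ∀ j → ∣ A j ∣ ≡ r ∸ 1
    ∣A∣ j = cong (_∸ 1) (trans (1+∣p-x∣≡∣p∣ (w∈E j)) (∣edge∣≡r (E∈ j)))

    -- Two vertices of one edge are joined by a path of one step, and `c` is constant on components.
    monochromatic : ∀ {e x y} → e ∈ edges H → x ∈ₛ e → y ∈ₛ e → c x ≡ c y
    monochromatic e∈ x∈e y∈e = Equivalence.from (comp _ _) ((-, e∈ , x∈e , y∈e) ◅ ε)

    colour : ∀ {j x} → x ∈ₛ A j → c x ≡ j
    colour {j} x∈A = trans (monochromatic (E∈ j) (p-x⊆p (E j) (w j) x∈A) (w∈E j)) (proj₂ (surj j))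

    A-disjoint : ∀ {i j x} → x ∈ₛ A i → x ∈ₛ A j → i ≡ j
    A-disjoint x∈Ai x∈Aj = trans (sym (colour x∈Ai)) (colour x∈Aj)

    -- An edge inside `U` has a single colour, so it lies in a single `A j`, which has one element
    -- too few to contain it.
    independent : ∀ {U} → (∀ {x} → x ∈ₛ U → ∃ λ j → x ∈ₛ A j) → ¬ Dependent U
    independent {U} U⊆ dep with e , e∈ , e⊆U ← find dep
      with x , x∈e ← 0<∣p∣⇒nonempty e (subst (1 ≤_) (sym (∣edge∣≡r e∈)) 1≤r) =
      <⇒≱ (subst (∣ A (c x) ∣ <_) (trans (1+∣p-x∣≡∣p∣ (w∈E (c x))) (trans (∣edge∣≡r (E∈ (c x))) (sym (∣edge∣≡r e∈)))) ≤-refl)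
          (p⊆q⇒∣p∣≤∣q∣ e⊆A)
      where
      e⊆A : e ⊆ A (c x)
      e⊆A {y} y∈e with j , y∈A ← U⊆ (e⊆U y∈e) =
        subst (λ j → y ∈ₛ A j) (trans (sym (colour y∈A)) (monochromatic e∈ y∈e x∈e)) y∈A

m*b≤a⇒m≤a-div-b : ∀ m a b → 1 ≤ b → m * b ≤ a → m ≤ a div b
m*b≤a⇒m≤a-div-b m a (suc b) _ m*b≤a =
  ≤-trans (≤-reflexive (sym (m*n/n≡m m (suc b)))) (/-monoˡ-≤ (suc b) m*b≤a)

theorem1p1 : (k r m n : ℕ) → 2 ≤ r → r < k → 1 ≤ m →
    k + ((k ∸ 2) C (r ∸ 1)) ≤ n →
    Σ ℕ (λ t → IsT n k r t × IsTm n k r m t) →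
    m ≤ (k ∸ 1) div (r ∸ 1)
theorem1p1 k r m n 2≤r r<k 1≤m large (t , (_ , minimal) , (H , covers , components , refl) , _) =
  m*b≤a⇒m≤a-div-b m (k ∸ 1) (r ∸ 1) (∸-monoˡ-≤ 1 2≤r) (∸-monoˡ-≤ {suc (m * (r ∸ 1))} 1
    (noIsolated⇒m*[r∸1]<k H covers components (≤-trans (n≤1+n 1) 2≤r) edgeAt))
  where
  -- Because `t` is the same number in both minima, `H` has the fewest edges among all covering
  -- r-graphs on `n` vertices. An isolated vertex would allow an even smaller one, against
  -- `minimal`.
  edgeAt : ∀ v → ∃ λ e → e ∈ edges H × v ∈ₛ e
  edgeAt v with Any.any? (v ∈?_) (edges H)
  ... | yes v∈some = find v∈some
  ... | no  v∉any = contradiction (minimal H′ covers′) (<⇒≱ smaller)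
    where
    fewer : Σ (RGraph r n) λ H′ → Covers k H′ × ∥ H′ ∥ < ∥ H ∥
    fewer = isolated⇒∃-smaller H covers {v} (λ e∈ v∈e → v∉any (lose e∈ v∈e)) 2≤r large
    H′ = proj₁ fewer
    covers′ = proj₁ (proj₂ fewer)
    smaller = proj₂ (proj₂ fewer)
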